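{- Let $\mathcal{C}$ be a class of languages closed under union and containing $\emptyset$, and let $L_1,L_2$ be two languages. The following properties are equivalent: 1. $L_1$ is $\mathcal{C}$-separable from $L_2$. 2. $(L_1,\{L_2\})$ is $\mathcal{C}$-coverable.
   Context: $A$ is a fixed finite alphabet; languages are subsets of $A^*$ and a class of languages is a set of languages over $A$. $L_1$ is $\mathcal{C}$-separable from $L_2$ if there is $K\in\mathcal{C}$ with $L_1\subseteq K$ and $K\cap L_2=\emptyset$. A $\mathcal{C}$-cover of a language $L$ is a finite set $\mathbf{K}$ of languages belonging to $\mathcal{C}$ with $L\subseteq\bigcup_{K\in\mathbf{K}}K$. A set $\mathbf{K}$ of languages is separating for a finite multiset of languages $\mathbf{L}$ if for every $K\in\mathbf{K}$ there exists $L'\in\mathbf{L}$ with $K\cap L'=\emptyset$. The pair $(L,\mathbf{L})$ is $\mathcal{C}$-coverable if there is a $\mathcal{C}$-cover of $L$ that is separating for $\mathbf{L}$. -}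

module Defs where

open import Data.Fin using (Fin)
open import Data.List using (List)
open import Data.List.Relation.Unary.All using (All)
open import Data.List.Relation.Unary.Any using (Any)
open import Data.Nat using (ℕ)
open import Data.Product using (∃-syntax; _×_)
open import Function.Bundles using (_↔_)
open import Level using (Level; 0ℓ) renaming (suc to lsuc; _⊔_ to _⊔ˡ_)
open import Relation.Binary.Definitions using (_Respects_)
open import Relation.Unary using (Pred; _∈_; _⊆_; _≐_; _∪_; _∩_; ∅)

Finite : Set → Set
Finite A = ∃[ n ] (A ↔ Fin n)

Language : Set → Set₁
Language A = Pred (List A) 0ℓ

-- Two languages are equal when they contain the same words (_≐_), so a set of
-- languages is a predicate that does not distinguish such languages.
record Class (A : Set) (c : Level) : Set (lsuc 0ℓ ⊔ˡ lsuc c) where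
  field
    member   : Pred (Language A) c
    respects : member Respects _≐_

open Class public

module _ {A : Set} {c : Level} where

  ClosedUnderUnion : Class A c → Set (lsuc 0ℓ ⊔ˡ c)
  ClosedUnderUnion C =
    (K L : Language A) → K ∈ member C → L ∈ member C → (K ∪ L) ∈ member C

  Separable : Class A c → Language A → Language A → Set (lsuc 0ℓ ⊔ˡ c)
  Separable C L₁ L₂ =
    ∃[ K ] (K ∈ member C × L₁ ⊆ K × (K ∩ L₂) ≐ ∅)

  -- Finite sets and finite multisets of languages are both given by lists.
  -- Order and repetitions play no role in the notions below, which only
  -- quantify over the entries.  The list of a cover may be empty.
  IsCover : Class A c → List (Language A) → Language A → Set (lsuc 0ℓ ⊔ˡ c)
  IsCover C Ks L =
    All (λ K → K ∈ member C) Ks × (L ⊆ λ w → Any (λ K → w ∈ K) Ks)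

Separating : {A : Set} → List (Language A) → List (Language A) → Set₁
Separating Ks Ls = All (λ K → Any (λ L → (K ∩ L) ≐ ∅) Ls) Ks

Coverable : {A : Set} {c : Level} →
            Class A c → Language A → List (Language A) → Set (lsuc 0ℓ ⊔ˡ c)
Coverable C L Ls = ∃[ Ks ] (IsCover C Ks L × Separating Ks Ls)

{-# OPTIONS --safe #-}
module Submission where

open import Defs
open import Data.List using (List; []; _∷_; [_]; foldr)
open import Data.List.Relation.Unary.All using (All; []; _∷_)
open import Data.List.Relation.Unary.Any using (Any; here; there)
open import Data.Product using (_,_)
open import Data.Sum using (inj₁; inj₂)
open import Function.Bundles using (_⇔_; mk⇔)
open import Level using (Level)
open import Relation.Unary using (_∈_; _≐_; _∪_; _∩_; ∅)

-- A separator forms a one-element cover. Conversely, since `L₂` is the only language to avoid,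
-- every member of a separating cover misses `L₂`, so the union of the cover is a separator: it
-- stays in the class (`⋃-member`) and still misses `L₂` (`⋃-disjoint`).

⋃ : {A : Set} → List (Language A) → Language A
⋃ = foldr _∪_ ∅

Any⇒∈⋃ : {A : Set} {Ks : List (Language A)} {w : List A} →
  Any (λ K → w ∈ K) Ks → w ∈ ⋃ Ks
Any⇒∈⋃ (here w∈K)   = inj₁ w∈K
Any⇒∈⋃ (there w∈Ks) = inj₂ (Any⇒∈⋃ w∈Ks)

⋃-member : {A : Set} {c : Level} (C : Class A c) →
  ClosedUnderUnion C → ∅ ∈ member C →
  {Ks : List (Language A)} → All (λ K → K ∈ member C) Ks → ⋃ Ks ∈ member C
-- A cover may be the empty list, whose union is `∅`.
⋃-member C ∪-closed ∅∈C []           = ∅∈C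
⋃-member C ∪-closed ∅∈C (K∈C ∷ Ks∈C) =
  ∪-closed _ _ K∈C (⋃-member C ∪-closed ∅∈C Ks∈C)

-- A single entry is essential: with several, different members of the list could avoid different
-- entries, and their union might meet all of them.
⋃-disjoint : {A : Set} {L : Language A} {Ks : List (Language A)} →
  Separating Ks [ L ] → (⋃ Ks ∩ L) ≐ ∅
⋃-disjoint {L = L} sep = (λ {w} (w∈⋃ , w∈L) → go sep w∈⋃ w∈L) , λ ()
  where
  go : ∀ {Ks w} → Separating Ks [ L ] → w ∈ ⋃ Ks → w ∈ L → w ∈ ∅
  -- `there` is impossible, as `[ L ]` has no further entry.
  go (here (K∩L⊆∅ , _) ∷ _) (inj₁ w∈K) w∈L = K∩L⊆∅ (w∈K , w∈L)
  go (_ ∷ sep)              (inj₂ w∈⋃) w∈L = go sep w∈⋃ w∈L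

theorem3p5 : {c : Level} (A : Set) → Finite A →
    (C : Class A c) → ClosedUnderUnion C → ∅ ∈ member C →
    (L₁ L₂ : Language A) →
    Separable C L₁ L₂ ⇔ Coverable C L₁ [ L₂ ]
theorem3p5 A _ C ∪-closed ∅∈C L₁ L₂ = mk⇔ to from
  where
  to : Separable C L₁ L₂ → Coverable C L₁ [ L₂ ]
  to (K , K∈C , L₁⊆K , K∩L₂≐∅) =
    [ K ] , (K∈C ∷ [] , λ w∈L₁ → here (L₁⊆K w∈L₁)) , here K∩L₂≐∅ ∷ []

  from : Coverable C L₁ [ L₂ ] → Separable C L₁ L₂
  from (Ks , (Ks∈C , L₁⊆Ks) , sep) =
    ⋃ Ks , ⋃-member C ∪-closed ∅∈C Ks∈C ,
    (λ w∈L₁ → Any⇒∈⋃ (L₁⊆Ks w∈L₁)) , ⋃-disjoint sep
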